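{- Let $R$ be a set of analytic structural rules of $\mathbf{MGL}$. Let $\vdash$ be the derivability relation of $\mathbf{MGL}\cup R$ and $\vdash_{cut}$ the derivability relation of $\mathbf{MGL}\cup R$ augmented with the cut rule. For all formulas $a_1,\dots,a_n,b$ and every term $G$ built from "$,$", $\circ$, $\epsilon$ such that $G(a_1,\dots,a_n)\vdash_{cut}b$, one has $G(a_1,\dots,a_n)\vdash b$.
   Context: Formulas are built from propositional variables by the constant $\underline 1$, binary symbols $\cdot,/,\setminus,\vee,\wedge$ and unary symbols $\lozenge,\blacksquare$. Structures are terms over formulas built with a binary symbol "$,$", a unary symbol $\circ$ and a constant $\epsilon$. A context $\Gamma[\ ]$ is a structure with one hole. A sequent is $\gamma\vdash a$, with $\gamma$ a structure and $a$ a formula. **Rules of $\mathbf{MGL}$** (premises / conclusion; $a,b,c$ formulas, $\gamma,\delta$ structures): $/\ a\vdash a$; $\Gamma[a,b]\vdash c\ /\ \Gamma[a\cdot b]\vdash c$; $\gamma\vdash a,\ \delta\vdash b\ /\ \gamma,\delta\vdash a\cdot b$; $\Gamma[b]\vdash c,\ \gamma\vdash a\ /\ \Gamma[b/a,\gamma]\vdash c$; $\gamma,a\vdash b\ /\ \gamma\vdash b/a$; $\gamma\vdash a,\ \Gamma[b]\vdash c\ /\ \Gamma[\gamma,a\setminus b]\vdash c$; $a,\gamma\vdash b\ /\ \gamma\vdash a\setminus b$; $\Gamma[\epsilon]\vdash a\ /\ \Gamma[\underline 1]\vdash a$; $/\ \epsilon\vdash\underline 1$; $\Gamma[a]\vdash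 c,\ \Gamma[b]\vdash c\ /\ \Gamma[a\vee b]\vdash c$; $\gamma\vdash a\ /\ \gamma\vdash a\vee b$; $\gamma\vdash b\ /\ \gamma\vdash a\vee b$; $\Gamma[a]\vdash c\ /\ \Gamma[a\wedge b]\vdash c$; $\Gamma[b]\vdash c\ /\ \Gamma[a\wedge b]\vdash c$; $\gamma\vdash a,\ \gamma\vdash b\ /\ \gamma\vdash a\wedge b$; $\Gamma[\circ a]\vdash b\ /\ \Gamma[\lozenge a]\vdash b$; $\gamma\vdash a\ /\ \circ\gamma\vdash\lozenge a$; $\Gamma[a]\vdash b\ /\ \Gamma[\circ\blacksquare a]\vdash b$; $\circ\gamma\vdash a\ /\ \gamma\vdash\blacksquare a$. **Cut rule**: $\gamma\vdash a,\ \Gamma[a]\vdash b\ /\ \Gamma[\gamma]\vdash b$. **Analytic structural rule**: a rule scheme $\Gamma[\Upsilon_1]\vdash A,\dots,\Gamma[\Upsilon_n]\vdash A\ /\ \Gamma[\Upsilon_0]\vdash A$, where $\Upsilon_0,\dots,\Upsilon_n$ are terms in structure variables built with "$,$", $\circ$, $\epsilon$ only, such that: $A$ is a formula variable and the structure variables occurring in $\Upsilon_0$ are distinct (each occurs once); $A$ does not occur in $\Upsilon_0$; every variable of each $\Upsilon_i$ occurs in $\Upsilon_0$. The context $\Gamma$ is arbitrary, and the rule may be instantiated with any structures and formula. -}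

module Defs where

open import Data.List.Base using (List; []; _∷_; _++_; map)
open import Data.List.Relation.Binary.Subset.Propositional using (_⊆_)
open import Data.List.Relation.Unary.All using (All)
open import Data.List.Relation.Unary.Unique.Propositional using (Unique)
open import Data.Nat.Base using (ℕ)
open import Level using (Level; _⊔_; suc)
open import Relation.Unary using (Pred; _∈_)

private
  variable
    x y v ℓ : Level
    X : Set x
    Y : Set y
    Var : Set v

infix 9 ◇_ ■_
infixl 8 _·_ _/_
infixr 8 _∖_
infixr 7 _∧_
infixr 6 _∨_

data Formula (Var : Set v) : Set v where
  atom                : Var → Formula Var
  𝟏                   : Formula Var
  _·_ _/_ _∖_ _∨_ _∧_ : Formula Var → Formula Var → Formula Var
  ◇_ ■_               : Formula Var → Formula Var

infix 8 ∘_
infix 7 _⨾_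

-- Free terms: `_⨾_` is the structural comma, and no associativity or
-- unit law is imposed.
data Term (X : Set x) : Set x where
  ⟨_⟩ : X → Term X
  _⨾_ : Term X → Term X → Term X
  ∘_  : Term X → Term X
  ε   : Term X

infix 9 _⟪_⟫

_⟪_⟫ : Term X → (X → Term Y) → Term Y
⟨ z ⟩   ⟪ σ ⟫ = σ z
(s ⨾ t) ⟪ σ ⟫ = (s ⟪ σ ⟫) ⨾ (t ⟪ σ ⟫)
(∘ t)   ⟪ σ ⟫ = ∘ (t ⟪ σ ⟫)
ε       ⟪ σ ⟫ = ε

vars : Term X → List X
vars ⟨ z ⟩   = z ∷ []
vars (s ⨾ t) = vars s ++ vars t
vars (∘ t)   = vars t
vars ε       = []

Structure : Set v → Set v
Structure Var = Term (Formula Var)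

data Context (Var : Set v) : Set v where
  □    : Context Var
  _⨾ˡ_ : Context Var → Structure Var → Context Var
  _⨾ʳ_ : Structure Var → Context Var → Context Var
  ∘ᶜ_  : Context Var → Context Var

infix 9 _[_]

_[_] : Context Var → Structure Var → Structure Var
□        [ γ ] = γ
(Γ ⨾ˡ δ) [ γ ] = (Γ [ γ ]) ⨾ δ
(δ ⨾ʳ Γ) [ γ ] = δ ⨾ (Γ [ γ ])
(∘ᶜ Γ)   [ γ ] = ∘ (Γ [ γ ])

infix 4 _⊢_

record Sequent (Var : Set v) : Set v where
  constructor _⊢_
  field
    antecedent : Structure Var
    succedent  : Formula Var

-- `𝓡 ps s` says that `s` follows from the premises `ps` by one
-- application of a rule in `𝓡`.
Rules : Set v → (ℓ : Level) → Set (v ⊔ suc ℓ)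
Rules Var ℓ = List (Sequent Var) → Sequent Var → Set ℓ

data Derivable {Var : Set v} (𝓡 : Rules Var ℓ) : Sequent Var → Set (v ⊔ ℓ) where
  infer : ∀ {ps s} → 𝓡 ps s → All (Derivable 𝓡) ps → Derivable 𝓡 s

data MGL {Var : Set v} : Rules Var v where
  identity : ∀ {a} → MGL [] (⟨ a ⟩ ⊢ a)
  ·L : ∀ Γ {a b c} →
       MGL ((Γ [ ⟨ a ⟩ ⨾ ⟨ b ⟩ ] ⊢ c) ∷ []) (Γ [ ⟨ a · b ⟩ ] ⊢ c)
  ·R : ∀ {γ δ a b} →
       MGL ((γ ⊢ a) ∷ (δ ⊢ b) ∷ []) (γ ⨾ δ ⊢ a · b)
  /L : ∀ Γ {γ a b c} →
       MGL ((Γ [ ⟨ b ⟩ ] ⊢ c) ∷ (γ ⊢ a) ∷ []) (Γ [ ⟨ b / a ⟩ ⨾ γ ] ⊢ c)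
  /R : ∀ {γ a b} →
       MGL ((γ ⨾ ⟨ a ⟩ ⊢ b) ∷ []) (γ ⊢ b / a)
  ∖L : ∀ Γ {γ a b c} →
       MGL ((γ ⊢ a) ∷ (Γ [ ⟨ b ⟩ ] ⊢ c) ∷ []) (Γ [ γ ⨾ ⟨ a ∖ b ⟩ ] ⊢ c)
  ∖R : ∀ {γ a b} →
       MGL ((⟨ a ⟩ ⨾ γ ⊢ b) ∷ []) (γ ⊢ a ∖ b)
  𝟏L : ∀ Γ {a} →
       MGL ((Γ [ ε ] ⊢ a) ∷ []) (Γ [ ⟨ 𝟏 ⟩ ] ⊢ a)
  𝟏R : MGL [] (ε ⊢ 𝟏)
  ∨L : ∀ Γ {a b c} →
       MGL ((Γ [ ⟨ a ⟩ ] ⊢ c) ∷ (Γ [ ⟨ b ⟩ ] ⊢ c) ∷ []) (Γ [ ⟨ a ∨ b ⟩ ] ⊢ c)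
  ∨R₁ : ∀ {γ a b} →
        MGL ((γ ⊢ a) ∷ []) (γ ⊢ a ∨ b)
  ∨R₂ : ∀ {γ a b} →
        MGL ((γ ⊢ b) ∷ []) (γ ⊢ a ∨ b)
  ∧L₁ : ∀ Γ {a b c} →
        MGL ((Γ [ ⟨ a ⟩ ] ⊢ c) ∷ []) (Γ [ ⟨ a ∧ b ⟩ ] ⊢ c)
  ∧L₂ : ∀ Γ {a b c} →
        MGL ((Γ [ ⟨ b ⟩ ] ⊢ c) ∷ []) (Γ [ ⟨ a ∧ b ⟩ ] ⊢ c)
  ∧R : ∀ {γ a b} →
       MGL ((γ ⊢ a) ∷ (γ ⊢ b) ∷ []) (γ ⊢ a ∧ b)
  ◇L : ∀ Γ {a b} →
       MGL ((Γ [ ∘ ⟨ a ⟩ ] ⊢ b) ∷ []) (Γ [ ⟨ ◇ a ⟩ ] ⊢ b)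
  ◇R : ∀ {γ a} →
       MGL ((γ ⊢ a) ∷ []) (∘ γ ⊢ ◇ a)
  ■L : ∀ Γ {a b} →
       MGL ((Γ [ ⟨ a ⟩ ] ⊢ b) ∷ []) (Γ [ ∘ ⟨ ■ a ⟩ ] ⊢ b)
  ■R : ∀ {γ a} →
       MGL ((∘ γ ⊢ a) ∷ []) (γ ⊢ ■ a)

data Cut {Var : Set v} : Rules Var v where
  cut : ∀ Γ {γ a b} →
        Cut ((γ ⊢ a) ∷ (Γ [ ⟨ a ⟩ ] ⊢ b) ∷ []) (Γ [ γ ] ⊢ b)

-- Structure variables are natural numbers. The ambient context and the
-- succedent A are not recorded: they are arbitrary and common to all the
-- sequents of the scheme (see `Structural`). Keeping A apart from the terms
-- also makes it automatic that A does not occur in them.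
record AnalyticRule : Set where
  field
    premises   : List (Term ℕ)
    conclusion : Term ℕ
    linear     : Unique (vars conclusion)
    contained  : All (λ Υ → vars Υ ⊆ vars conclusion) premises

data Structural {Var : Set v} (R : Pred AnalyticRule ℓ) : Rules Var (v ⊔ ℓ) where
  structural : ∀ {r} → r ∈ R →
               ∀ (Γ : Context Var) (σ : ℕ → Structure Var) (c : Formula Var) →
               let open AnalyticRule r in
               Structural R (map (λ Υ → Γ [ Υ ⟪ σ ⟫ ] ⊢ c) premises)
                            (Γ [ conclusion ⟪ σ ⟫ ] ⊢ c)

{-# OPTIONS --safe #-}

-- Semantic cut elimination. Formulas are interpreted as sets of structures
-- closed under an operator built from cut-free derivability, and structures as
-- unclosed images of these sets. All rules, including cut, are sound because a
-- hypothesis about the elements of X passes to Cl X inside any context; for an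
-- analytic rule, linearity of the conclusion Υ₀ makes every element of its image
-- an instance of Υ₀, to which the rule applies again.
-- Conversely ⟨ a ⟩ ∈ ⟦ a ⟧ ⊆ { γ | γ ⊢ a } (Okada's lemma), so evaluating a
-- derivable sequent at its own antecedent yields a cut-free derivation.
module Submission where

open import Defs
open import Data.Fin.Base using (Fin)
open import Data.List.Base using (List; []; _∷_; _++_)
open import Data.List.Membership.Propositional using () renaming (_∈_ to _∈ₗ_)
open import Data.List.Membership.Propositional.Properties using (∈-++⁺ˡ; ∈-++⁺ʳ; ∈-++⁻)
open import Data.List.Relation.Unary.All as All using (All; []; _∷_)
open import Data.List.Relation.Unary.All.Properties as Allₚ using ()
open import Data.List.Relation.Unary.AllPairs using ([]; _∷_)
open import Data.List.Relation.Unary.Any using (here; there)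
open import Data.List.Relation.Unary.Unique.Propositional using (Unique)
open import Data.Nat.Base using (ℕ)
open import Data.Nat.Properties using (_≟_)
open import Data.Product.Base using (∃; _×_; _,_)
open import Data.Sum.Base using (inj₁; inj₂)
open import Level using (Level; _⊔_)
open import Relation.Binary.Construct.Union using (_∪_)
open import Relation.Binary.PropositionalEquality
  using (_≡_; refl; sym; cong; cong₂; subst)
open import Relation.Nullary using (¬_; yes; no; contradiction)
open import Relation.Unary using (Pred; _∈_; _⊆_; _∩_) renaming (_∪_ to _∪ᵖ_)

open import Data.List.Membership.DecPropositional _≟_ using (_∈?_)

private
  variable
    x y v ℓ : Level
    X : Set x
    Y : Set y

-- Substitutions, repetition-free variable lists, composition of contexts.

⟪⟫-cong : (t : Term X) {σ τ : X → Term Y} →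
          (∀ {i} → i ∈ₗ vars t → σ i ≡ τ i) → t ⟪ σ ⟫ ≡ t ⟪ τ ⟫
⟪⟫-cong ⟨ z ⟩   eq = eq (here refl)
⟪⟫-cong (s ⨾ t) eq = cong₂ _⨾_ (⟪⟫-cong s (λ i → eq (∈-++⁺ˡ i)))
                                (⟪⟫-cong t (λ i → eq (∈-++⁺ʳ (vars s) i)))
⟪⟫-cong (∘ t)   eq = cong ∘_ (⟪⟫-cong t eq)
⟪⟫-cong ε       eq = refl

Unique-++⁻ : (xs : List X) {ys : List X} → Unique (xs ++ ys) →
             Unique xs × Unique ys × (∀ {z} → z ∈ₗ xs → ¬ z ∈ₗ ys)
Unique-++⁻ []       u        = [] , u , λ ()
Unique-++⁻ (x ∷ xs) (x∉ ∷ u) with Unique-++⁻ xs u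
... | uxs , uys , disjoint =
  Allₚ.++⁻ˡ xs x∉ ∷ uxs , uys ,
  λ { (here refl) z∈ys → All.lookup (Allₚ.++⁻ʳ xs x∉) z∈ys refl
    ; (there z∈xs)     → disjoint z∈xs }

_∘ᶜᶜ_ : {Var : Set v} → Context Var → Context Var → Context Var
□        ∘ᶜᶜ Δ = Δ
(Γ ⨾ˡ δ) ∘ᶜᶜ Δ = (Γ ∘ᶜᶜ Δ) ⨾ˡ δ
(δ ⨾ʳ Γ) ∘ᶜᶜ Δ = δ ⨾ʳ (Γ ∘ᶜᶜ Δ)
(∘ᶜ Γ)   ∘ᶜᶜ Δ = ∘ᶜ (Γ ∘ᶜᶜ Δ)

∘ᶜᶜ-[] : {Var : Set v} (Γ Δ : Context Var) (γ : Structure Var) →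
         (Γ ∘ᶜᶜ Δ) [ γ ] ≡ Γ [ Δ [ γ ] ]
∘ᶜᶜ-[] □        Δ γ = refl
∘ᶜᶜ-[] (Γ ⨾ˡ δ) Δ γ = cong (_⨾ δ) (∘ᶜᶜ-[] Γ Δ γ)
∘ᶜᶜ-[] (δ ⨾ʳ Γ) Δ γ = cong (δ ⨾_) (∘ᶜᶜ-[] Γ Δ γ)
∘ᶜᶜ-[] (∘ᶜ Γ)   Δ γ = cong ∘_ (∘ᶜᶜ-[] Γ Δ γ)

module CutFree {v ℓ} {Var : Set v} (R : Pred AnalyticRule ℓ) where

  private
    variable
      P Q : Pred (Structure Var) (v ⊔ ℓ)
      γ δ : Structure Var
      a b c : Formula Var
      σ : ℕ → Structure Var

  infixl 8 _⊗_

  data _⊗_ (P Q : Pred (Structure Var) (v ⊔ ℓ)) : Pred (Structure Var) (v ⊔ ℓ) where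
    _⨾_ : ∀ {γ δ} → γ ∈ P → δ ∈ Q → (γ ⨾ δ) ∈ P ⊗ Q

  data Circ (P : Pred (Structure Var) (v ⊔ ℓ)) : Pred (Structure Var) (v ⊔ ℓ) where
    ∘_ : ∀ {γ} → γ ∈ P → (∘ γ) ∈ Circ P

  data Unit : Pred (Structure Var) (v ⊔ ℓ) where
    ε : ε ∈ Unit

  Provable : Sequent Var → Set (v ⊔ ℓ)
  Provable = Derivable (MGL ∪ Structural R)

  mgl : ∀ {ps s} → MGL ps s → All Provable ps → Provable s
  mgl r = infer (inj₁ r)

  -- The closure operator whose basic closed sets are the { γ | Γ [ γ ] ⊢ c }: an element must pass
  -- every test (`Γ`, `c`) that all of `P` passes.
  Cl : Pred (Structure Var) (v ⊔ ℓ) → Pred (Structure Var) (v ⊔ ℓ)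
  Cl P γ = ∀ Γ c → (∀ {δ} → δ ∈ P → Provable (Γ [ δ ] ⊢ c)) → Provable (Γ [ γ ] ⊢ c)

  η : P ⊆ Cl P
  η p Γ c h = h p

  -- Plugging `Δ` into a test context gives a test context again, so a test of `Δ [ γ ]` is already
  -- a test of `γ`.
  Cl-bind : ∀ Δ → (∀ {δ} → δ ∈ P → Δ [ δ ] ∈ Cl Q) → γ ∈ Cl P → Δ [ γ ] ∈ Cl Q
  Cl-bind Δ f p Γ c h =
    subst (λ γ → Provable (γ ⊢ c)) (∘ᶜᶜ-[] Γ Δ _)
      (p (Γ ∘ᶜᶜ Δ) c λ q →
        subst (λ γ → Provable (γ ⊢ c)) (sym (∘ᶜᶜ-[] Γ Δ _)) (f q Γ c h))

  ⟦_⟧ : Formula Var → Pred (Structure Var) (v ⊔ ℓ)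
  ⟦ atom p ⟧ γ = Provable (γ ⊢ atom p)
  ⟦ 𝟏 ⟧        = Cl Unit
  ⟦ a · b ⟧    = Cl (⟦ a ⟧ ⊗ ⟦ b ⟧)
  ⟦ b / a ⟧ γ  = ∀ {δ} → δ ∈ ⟦ a ⟧ → (γ ⨾ δ) ∈ ⟦ b ⟧
  ⟦ a ∖ b ⟧ γ  = ∀ {δ} → δ ∈ ⟦ a ⟧ → (δ ⨾ γ) ∈ ⟦ b ⟧
  ⟦ a ∨ b ⟧    = Cl (⟦ a ⟧ ∪ᵖ ⟦ b ⟧)
  ⟦ a ∧ b ⟧    = ⟦ a ⟧ ∩ ⟦ b ⟧
  ⟦ ◇ a ⟧      = Cl (Circ ⟦ a ⟧)
  ⟦ ■ a ⟧ γ    = (∘ γ) ∈ ⟦ a ⟧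

  -- An atom denotes a basic closed set, tested at `□`. Residuals and `■` need no explicit `Cl`:
  -- `Cl-bind` moves the closure through one comma or one `∘`, which leaves closedness of a smaller
  -- formula.
  Cl-closed : ∀ a → Cl ⟦ a ⟧ ⊆ ⟦ a ⟧
  Cl-closed (atom p) k     = k □ (atom p) λ d → d
  Cl-closed 𝟏        k     = Cl-bind □ (λ p → p) k
  Cl-closed (a · b)  k     = Cl-bind □ (λ p → p) k
  Cl-closed (b / a)  k {δ} d = Cl-closed b (Cl-bind (□ ⨾ˡ δ) (λ p → η (p d)) k)
  Cl-closed (a ∖ b)  k {δ} d = Cl-closed b (Cl-bind (δ ⨾ʳ □) (λ p → η (p d)) k)
  Cl-closed (a ∨ b)  k     = Cl-bind □ (λ p → p) k
  Cl-closed (a ∧ b)  k     = Cl-closed a (Cl-bind □ (λ (p , _) → η p) k)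
                           , Cl-closed b (Cl-bind □ (λ (_ , q) → η q) k)
  Cl-closed (◇ a)    k     = Cl-bind □ (λ p → p) k
  Cl-closed (■ a)    k     = Cl-closed a (Cl-bind (∘ᶜ □) η k)

  mutual
    -- Unfolding `Cl`, or introducing it by `Cl-closed`, turns the goal into an arbitrary test (`Γ`,
    -- `c`), which is the conclusion of a left rule. The recursion with `reify` is mutual because
    -- residuals are contravariant in `a`.
    reflect : ∀ a → ⟨ a ⟩ ∈ ⟦ a ⟧
    reflect (atom p)    = mgl identity []
    reflect 𝟏       Γ c h = mgl (𝟏L Γ) (h ε ∷ [])
    reflect (a · b) Γ c h = mgl (·L Γ) (h (reflect a ⨾ reflect b) ∷ [])
    reflect (b / a) d   = Cl-closed b λ Γ c h →
      mgl (/L Γ) (h (reflect b) ∷ reify a d ∷ [])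
    reflect (a ∖ b) d   = Cl-closed b λ Γ c h →
      mgl (∖L Γ) (reify a d ∷ h (reflect b) ∷ [])
    reflect (a ∨ b) Γ c h =
      mgl (∨L Γ) (h (inj₁ (reflect a)) ∷ h (inj₂ (reflect b)) ∷ [])
    reflect (a ∧ b)     =
        Cl-closed a (λ Γ c h → mgl (∧L₁ Γ) (h (reflect a) ∷ []))
      , Cl-closed b (λ Γ c h → mgl (∧L₂ Γ) (h (reflect b) ∷ []))
    reflect (◇ a)   Γ c h = mgl (◇L Γ) (h (∘ reflect a) ∷ [])
    reflect (■ a)       = Cl-closed a λ Γ c h → mgl (■L Γ) (h (reflect a) ∷ [])

    -- Testing a closure at `□` and at the formula itself leaves just a right rule to apply. For
    -- residuals, `⟨ a ⟩` serves as generic argument.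
    reify : ∀ a → γ ∈ ⟦ a ⟧ → Provable (γ ⊢ a)
    reify (atom p) d = d
    reify 𝟏       k  = k □ 𝟏 λ { ε → mgl 𝟏R [] }
    reify (a · b) k  = k □ (a · b) λ { (p ⨾ q) → mgl ·R (reify a p ∷ reify b q ∷ []) }
    reify (b / a) f  = mgl /R (reify b (f (reflect a)) ∷ [])
    reify (a ∖ b) f  = mgl ∖R (reify b (f (reflect a)) ∷ [])
    reify (a ∨ b) k  = k □ (a ∨ b) λ { (inj₁ p) → mgl ∨R₁ (reify a p ∷ [])
                                     ; (inj₂ q) → mgl ∨R₂ (reify b q ∷ []) }
    reify (a ∧ b) (p , q) = mgl ∧R (reify a p ∷ reify b q ∷ [])
    reify (◇ a)   k  = k □ (◇ a) λ { (∘ p) → mgl ◇R (reify a p ∷ []) }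
    reify (■ a)   p  = mgl ■R (reify a p ∷ [])

  -- Interpretation of structures and replacement inside a context.

  ⟦_⟧ˢ : Structure Var → Pred (Structure Var) (v ⊔ ℓ)
  ⟦ ⟨ a ⟩ ⟧ˢ = ⟦ a ⟧
  ⟦ s ⨾ t ⟧ˢ = ⟦ s ⟧ˢ ⊗ ⟦ t ⟧ˢ
  ⟦ ∘ t ⟧ˢ   = Circ ⟦ t ⟧ˢ
  ⟦ ε ⟧ˢ     = Unit

  reflectˢ : ∀ γ → γ ∈ ⟦ γ ⟧ˢ
  reflectˢ ⟨ a ⟩   = reflect a
  reflectˢ (s ⨾ t) = reflectˢ s ⨾ reflectˢ t
  reflectˢ (∘ t)   = ∘ reflectˢ t
  reflectˢ ε       = ε

  Valid : Sequent Var → Set (v ⊔ ℓ)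
  Valid (γ ⊢ a) = ⟦ γ ⟧ˢ ⊆ ⟦ a ⟧

  -- The last field ranges over every `γ′` because the premises of a left rule put other structures
  -- into the hole of `Γ`; the same `Δ` serves them all.
  data Focus (Γ : Context Var) (γ : Structure Var) : Pred (Structure Var) (v ⊔ ℓ) where
    focus : ∀ Δ {δ} → δ ∈ ⟦ γ ⟧ˢ →
            (∀ {γ′ δ′} → δ′ ∈ ⟦ γ′ ⟧ˢ → Δ [ δ′ ] ∈ ⟦ Γ [ γ′ ] ⟧ˢ) →
            Focus Γ γ (Δ [ δ ])

  focusing : ∀ Γ → ⟦ Γ [ γ ] ⟧ˢ ⊆ Focus Γ γ
  focusing □        p       = focus □ p (λ q → q)
  focusing (Γ ⨾ˡ γ) (p ⨾ q) with focusing Γ p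
  ... | focus Δ d f = focus (Δ ⨾ˡ _) d (λ {γ′} d′ → f {γ′} d′ ⨾ q)
  focusing (γ ⨾ʳ Γ) (p ⨾ q) with focusing Γ q
  ... | focus Δ d f = focus (_ ⨾ʳ Δ) d (λ {γ′} d′ → p ⨾ f {γ′} d′)
  focusing (∘ᶜ Γ)   (∘ p)   with focusing Γ p
  ... | focus Δ d f = focus (∘ᶜ Δ) d (λ {γ′} d′ → ∘ f {γ′} d′)

  data Premise (Γ : Context Var) (c : Formula Var) : Pred (Structure Var) (v ⊔ ℓ) where
    premise : ∀ γ {δ} → δ ∈ ⟦ γ ⟧ˢ → Valid (Γ [ γ ] ⊢ c) → Premise Γ c δ

  -- After focusing, the closure around the filler moves out through `Δ` and is absorbed by
  -- `Cl-closed c`. Rules acting inside a context thus need checking only at the hole, whatever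
  -- their number of premises.
  left-sound : ∀ Γ γ c → ⟦ γ ⟧ˢ ⊆ Cl (Premise Γ c) → Valid (Γ [ γ ] ⊢ c)
  left-sound Γ γ c k p with focusing {γ} Γ p
  ... | focus Δ d f = Cl-closed c
    (Cl-bind Δ (λ { (premise γ′ d′ valid) → η (valid (f {γ′} d′)) }) (k d))

  MGL-sound : ∀ {ps s} → MGL ps s → All Valid ps → Valid s
  MGL-sound identity [] p = p
  MGL-sound (·L Γ {a} {b} {c}) (f ∷ []) =
    left-sound Γ ⟨ a · b ⟩ c (Cl-bind □ λ p → η (premise (⟨ a ⟩ ⨾ ⟨ b ⟩) p f))
  MGL-sound ·R (f ∷ g ∷ []) (p ⨾ q) = η (f p ⨾ g q)
  MGL-sound (/L Γ {γ} {a} {b} {c}) (f ∷ g ∷ []) =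
    -- The premise `g` makes the right component an argument for the residual `h`, so the whole pair
    -- already lies in `⟦ b ⟧`.
    left-sound Γ (⟨ b / a ⟩ ⨾ γ) c λ { (h ⨾ q) → η (premise ⟨ b ⟩ (h (g q)) f) }
  MGL-sound /R (f ∷ []) p q = f (p ⨾ q)
  MGL-sound (∖L Γ {γ} {a} {b} {c}) (g ∷ f ∷ []) =
    left-sound Γ (γ ⨾ ⟨ a ∖ b ⟩) c λ { (q ⨾ h) → η (premise ⟨ b ⟩ (h (g q)) f) }
  MGL-sound ∖R (f ∷ []) p q = f (q ⨾ p)
  MGL-sound (𝟏L Γ {c}) (f ∷ []) =
    left-sound Γ ⟨ 𝟏 ⟩ c (Cl-bind □ λ p → η (premise ε p f))
  MGL-sound 𝟏R [] ε = η ε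
  MGL-sound (∨L Γ {a} {b} {c}) (f ∷ g ∷ []) =
    left-sound Γ ⟨ a ∨ b ⟩ c
      (Cl-bind □ λ { (inj₁ p) → η (premise ⟨ a ⟩ p f)
                   ; (inj₂ q) → η (premise ⟨ b ⟩ q g) })
  MGL-sound ∨R₁ (f ∷ []) p = η (inj₁ (f p))
  MGL-sound ∨R₂ (f ∷ []) p = η (inj₂ (f p))
  MGL-sound (∧L₁ Γ {a} {b} {c}) (f ∷ []) =
    left-sound Γ ⟨ a ∧ b ⟩ c λ (p , _) → η (premise ⟨ a ⟩ p f)
  MGL-sound (∧L₂ Γ {a} {b} {c}) (f ∷ []) =
    left-sound Γ ⟨ a ∧ b ⟩ c λ (_ , q) → η (premise ⟨ b ⟩ q f)
  MGL-sound ∧R (f ∷ g ∷ []) p = f p , g p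
  MGL-sound (◇L Γ {a} {c}) (f ∷ []) =
    left-sound Γ ⟨ ◇ a ⟩ c (Cl-bind □ λ p → η (premise (∘ ⟨ a ⟩) p f))
  MGL-sound ◇R (f ∷ []) (∘ p) = η (∘ f p)
  MGL-sound (■L Γ {a} {c}) (f ∷ []) =
    left-sound Γ (∘ ⟨ ■ a ⟩) c λ { (∘ p) → η (premise ⟨ a ⟩ p f) }
  MGL-sound ■R (f ∷ []) p = f (∘ p)

  Cut-sound : ∀ {ps s} → Cut ps s → All Valid ps → Valid s
  Cut-sound (cut Γ {γ} {a} {c}) (f ∷ g ∷ []) =
    -- Cut behaves like a left rule: `f` reads an element of `⟦ γ ⟧ˢ` as one of `⟦ a ⟧`, where `g`
    -- applies.
    left-sound Γ γ c λ p → η (premise ⟨ a ⟩ (f p) g)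

  Realizes : (τ σ : ℕ → Structure Var) (Υ : Term ℕ) → Set (v ⊔ ℓ)
  Realizes τ σ Υ = ∀ {i} → i ∈ₗ vars Υ → τ i ∈ ⟦ σ i ⟧ˢ

  ⟪⟫-realizes : ∀ Υ {τ σ} → Realizes τ σ Υ → Υ ⟪ τ ⟫ ∈ ⟦ Υ ⟪ σ ⟫ ⟧ˢ
  ⟪⟫-realizes ⟨ i ⟩   h = h (here refl)
  ⟪⟫-realizes (s ⨾ t) h = ⟪⟫-realizes s (λ i → h (∈-++⁺ˡ i))
                        ⨾ ⟪⟫-realizes t (λ i → h (∈-++⁺ʳ (vars s) i))
  ⟪⟫-realizes (∘ t)   h = ∘ ⟪⟫-realizes t h
  ⟪⟫-realizes ε       h = ε

  -- A repeated variable could be matched with two different elements of the same set. Under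
  -- linearity the two sides of a comma share no variable, so their assignments glue.
  linear-realizer : ∀ Υ → Unique (vars Υ) → δ ∈ ⟦ Υ ⟪ σ ⟫ ⟧ˢ →
                    ∃ λ τ → Υ ⟪ τ ⟫ ≡ δ × Realizes τ σ Υ
  linear-realizer {δ = δ} ⟨ i ⟩ u p = (λ _ → δ) , refl , λ { (here refl) → p }
  linear-realizer {σ = σ} (s ⨾ t) u (p ⨾ q)
    with us , ut , disjoint ← Unique-++⁻ (vars s) u
    with τₛ , refl , hₛ ← linear-realizer s us p
       | τₜ , refl , hₜ ← linear-realizer t ut q
    = τ , cong₂ _⨾_ (⟪⟫-cong s τ≡τₛ) (⟪⟫-cong t τ≡τₜ) , h
    where
    τ : ℕ → Structure Var
    -- Outside `vars s` the value defaults to `τₜ`; disjointness makes this correct on all of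
    -- `vars t`.
    τ i with i ∈? vars s
    ... | yes _ = τₛ i
    ... | no  _ = τₜ i
    τ≡τₛ : ∀ {i} → i ∈ₗ vars s → τ i ≡ τₛ i
    τ≡τₛ {i} i∈s with i ∈? vars s
    ... | yes _   = refl
    ... | no  i∉s = contradiction i∈s i∉s
    τ≡τₜ : ∀ {i} → i ∈ₗ vars t → τ i ≡ τₜ i
    τ≡τₜ {i} i∈t with i ∈? vars s
    ... | yes i∈s = contradiction i∈t (disjoint i∈s)
    ... | no  _   = refl
    h : Realizes τ σ (s ⨾ t)
    h {i} i∈ with ∈-++⁻ (vars s) i∈
    ... | inj₁ i∈s = subst (_∈ ⟦ σ i ⟧ˢ) (sym (τ≡τₛ i∈s)) (hₛ i∈s)
    ... | inj₂ i∈t = subst (_∈ ⟦ σ i ⟧ˢ) (sym (τ≡τₜ i∈t)) (hₜ i∈t)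
  linear-realizer (∘ t) u (∘ p) with τ , refl , h ← linear-realizer t u p = τ , refl , h
  linear-realizer ε u ε = (λ _ → ε) , refl , λ ()

  Structural-sound : ∀ {ps s} → Structural R ps s → All Valid ps → Valid s
  Structural-sound (structural {r} r∈R Γ σ c) valid =
    left-sound Γ (conclusion ⟪ σ ⟫) c covered
    where
    open AnalyticRule r
    covered : ⟦ conclusion ⟪ σ ⟫ ⟧ˢ ⊆ Cl (Premise Γ c)
    -- The rule is applied afresh in the test context `Δ` with succedent `d`, instantiated by `τ`
    -- instead of `σ`. By `contained`, `τ` realizes every premise too, so `k` proves them.
    covered p Δ d k with τ , refl , h ← linear-realizer conclusion linear p =
      infer (inj₂ (structural r∈R Δ τ d))
        (Allₚ.map⁺ (All.zipWith {Q = λ Υ → Valid (Γ [ Υ ⟪ σ ⟫ ] ⊢ c)}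
          (λ {Υ} (Υ⊆ , f) → k (premise (Υ ⟪ σ ⟫) (⟪⟫-realizes Υ (λ i∈ → h (Υ⊆ i∈))) f))
          (contained , Allₚ.map⁻ valid)))

  mutual
    sound : ∀ {s} → Derivable (MGL ∪ Structural R ∪ Cut) s → Valid s
    sound (infer (inj₁ r)        ds) = MGL-sound r (sounds ds)
    sound (infer (inj₂ (inj₁ r)) ds) = Structural-sound r (sounds ds)
    sound (infer (inj₂ (inj₂ r)) ds) = Cut-sound r (sounds ds)

    sounds : ∀ {ps} → All (Derivable (MGL ∪ Structural R ∪ Cut)) ps → All Valid ps
    sounds []       = []
    sounds (d ∷ ds) = sound d ∷ sounds ds

  cut-elimination : Derivable (MGL ∪ Structural R ∪ Cut) (γ ⊢ a) → Provable (γ ⊢ a)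
  cut-elimination {γ} {a} d = reify a (sound d (reflectˢ γ))

corollary8p1p13 : ∀ {v ℓ} {Var : Set v} (R : Pred AnalyticRule ℓ)
    (n : ℕ) (a : Fin n → Formula Var) (b : Formula Var) (G : Term (Fin n)) →
    Derivable (MGL ∪ Structural R ∪ Cut) (G ⟪ (λ i → ⟨ a i ⟩) ⟫ ⊢ b) →
    Derivable (MGL ∪ Structural R) (G ⟪ (λ i → ⟨ a i ⟩) ⟫ ⊢ b)
corollary8p1p13 R n a b G = CutFree.cut-elimination R
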